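{- Let $D$ be an oriented split graph whose vertex set is partitioned into $X$ and $Y$ such that $X$ is an independent set and $D[Y]$ is an almost regular tournament of order $2d$. Then $D$ has a Seymour vertex, i.e. a vertex $u$ with $|N^{++}(u)|\ge |N^+(u)|$.
   Context: An oriented graph is a loopless digraph in which $xy\in A$ implies $yx\notin A$; $D$ is assumed to be such. A tournament is almost regular if $|d^+(x)-d^-(x)|=1$ for each vertex $x$. $N^+(u)=\{v:uv\in A(D)\}$, $N^{++}(u)=\{v: uw,wv\in A(D)\text{ for some } w\}\setminus N^+(u)$. -}

module Defs where

open import Data.Nat using (ℕ; zero; suc; _≤_; _<_; _*_)
open import Data.Bool using (Bool; true; false; _∧_; _∨_; not)
open import Data.Fin using (Fin; zero; suc)
open import Data.Fin.Subset using (Subset; ∣_∣)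
open import Data.Vec using (tabulate)
open import Data.Sum using (_⊎_)
open import Data.Product using (_×_)
open import Relation.Binary.PropositionalEquality using (_≡_)
open import Relation.Nullary using (¬_)

Digraph : ℕ → Set
Digraph n = Fin n → Fin n → Bool

existsB : ∀ {n} → (Fin n → Bool) → Bool
existsB {zero}  p = false
existsB {suc n} p = p zero ∨ existsB (λ i → p (suc i))

count : ∀ {n} → (Fin n → Bool) → ℕ
count p = ∣ tabulate p ∣

Oriented : ∀ {n} → Digraph n → Set
Oriented {n} A =
  ((u : Fin n) → A u u ≡ false) × ((u v : Fin n) → A u v ≡ true → A v u ≡ false)

outN : ∀ {n} → Digraph n → Fin n → Fin n → Bool
outN A u v = A u v

secondOutN : ∀ {n} → Digraph n → Fin n → Fin n → Bool
secondOutN A u v = existsB (λ w → A u w ∧ A w v) ∧ not (A u v)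

outdeg : ∀ {n} → Digraph n → Fin n → ℕ
outdeg A u = count (outN A u)

secondOutdeg : ∀ {n} → Digraph n → Fin n → ℕ
secondOutdeg A u = count (secondOutN A u)

SeymourVertex : ∀ {n} → Digraph n → Fin n → Set
SeymourVertex A u = outdeg A u ≤ secondOutdeg A u

-- Y : Fin n → Bool is the part Y of the partition; X is its complement.
-- X is independent: no arc between two vertices of X.
IndependentX : ∀ {n} → Digraph n → (Fin n → Bool) → Set
IndependentX {n} A Y = (u v : Fin n) → Y u ≡ false → Y v ≡ false → A u v ≡ false

-- D[Y] is a tournament: any two distinct vertices of Y are joined by an arc
-- (at most one arc is guaranteed by orientedness).
TournamentOn : ∀ {n} → Digraph n → (Fin n → Bool) → Set
TournamentOn {n} A Y =
  (u v : Fin n) → Y u ≡ true → Y v ≡ true → ¬ (u ≡ v) → (A u v ≡ true) ⊎ (A v u ≡ true)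

outdegIn : ∀ {n} → Digraph n → (Fin n → Bool) → Fin n → ℕ
outdegIn A Y u = count (λ v → Y v ∧ A u v)

indegIn : ∀ {n} → Digraph n → (Fin n → Bool) → Fin n → ℕ
indegIn A Y u = count (λ v → Y v ∧ A v u)

AlmostRegularOn : ∀ {n} → Digraph n → (Fin n → Bool) → Set
AlmostRegularOn {n} A Y =
  (u : Fin n) → Y u ≡ true →
    (outdegIn A Y u ≡ suc (indegIn A Y u)) ⊎ (indegIn A Y u ≡ suc (outdegIn A Y u))

{-# OPTIONS --safe #-}
module Submission where

-- Suppose that no vertex is a Seymour vertex. Write |Y| = 2d and let low ⊆ Y be the d vertices of
-- out-degree d − 1 in D[Y]; all other vertices of Y have out-degree d there. A nonempty set R ⊆ Y all of whose
-- vertices are dominated by the same i vertices outside R satisfies 2i + |R| ≤ 2d + 1 by counting the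
-- arcs inside R, and equality forces in-degree d on all of R; dually for R dominating i vertices.
--
-- Applied to the vertices of Y that x ∈ X does not reach in two steps, this gives first that x reaches
-- all of Y, and then |N⁺(x)| > d. Applied to the set R of vertices of Y not reaching x in two steps, it
-- gives |N⁻(x)| ≤ |N⁻⁻(x) ∩ Y| + 1; call x exceptional if equality holds, in which case R ⊆ low.
--
-- For y ∈ Y the surplus of N⁺(y) ∩ X over N⁺⁺(y) ∩ X is ≥ 0, ≥ 1 if y ∈ low, and ≥ 2 if moreover all
-- in-neighbours of y in Y lie in N⁺⁺(y), as happens for y ∈ R. Double counting the pairs (y , x) shows that
-- there are at least d + |R| ≥ 2|R| exceptional vertices. But x has an out-neighbour y ∈ Y outside low; every
-- exceptional vertex lies in N⁺(y) or N⁺⁺(y), so there are at most 2 |N⁺(y) ∩ X| ≤ 2 |N⁺⁺(x) ∩ X| < 2|R| of them.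

open import Defs
import Algebra.Properties.Semiring.Sum
open import Data.Bool as Bool using (Bool; true; false; _∧_; _∨_; not)
open import Data.Bool.Properties using (∧-conicalˡ; ∧-conicalʳ; ∨-zeroʳ; T-≡)
open import Data.Empty using (⊥; ⊥-elim)
open import Data.Fin using (Fin; zero; suc; _≟_; fromℕ<)
open import Data.Fin.Properties using (any?)
open import Data.Nat using (ℕ; zero; suc; _+_; _*_; _≤_; _<_; z≤n; s≤s; _<ᵇ_; >-nonZero; _≤?_)
open import Data.Nat.Properties hiding (_≟_; _≤?_)
open import Data.Nat.Tactic.RingSolver using (solve-∀)
open import Data.Product using (Σ; ∃; _×_; _,_; proj₁; proj₂)
open import Data.Sum using (_⊎_; inj₁; inj₂; [_,_]; swap)
open import Function using (_∘_; flip)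
open import Function.Bundles using (Equivalence)
open import Relation.Binary.PropositionalEquality hiding ([_])
open import Relation.Nullary using (¬_; yes; no; does; contradiction)
open import Relation.Nullary.Decidable using (dec-true)

open Algebra.Properties.Semiring.Sum +-*-semiring
  using (sum; sum-cong-≗; ∑-distrib-+; ∑-comm; *-distribˡ-sum; *-distribʳ-sum)

-- Booleans

bool-cases : ∀ b → b ≡ true ⊎ b ≡ false
bool-cases true  = inj₁ refl
bool-cases false = inj₂ refl

true≢false : ∀ {b} → b ≡ true → b ≡ false → ⊥
true≢false refl ()

not-true : ∀ {b} → not b ≡ true → b ≡ false
not-true {false} _ = refl

<ᵇ-true : ∀ {m n} → m < n → (m <ᵇ n) ≡ true
<ᵇ-true = Equivalence.to T-≡ ∘ <⇒<ᵇ

<ᵇ-true⁻¹ : ∀ {m n} → (m <ᵇ n) ≡ true → m < n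
<ᵇ-true⁻¹ {m} {n} = <ᵇ⇒< m n ∘ Equivalence.from T-≡

𝟙 : Bool → ℕ
𝟙 true  = 1
𝟙 false = 0

-- Subsets of Fin n as Boolean predicates

module _ {n : ℕ} where

  infix 4 _∈_ _⊆_
  infixr 6 _∪_

  _∈_ : Fin n → (Fin n → Bool) → Set
  v ∈ p = p v ≡ true

  _⊆_ : (p q : Fin n → Bool) → Set
  p ⊆ q = ∀ v → v ∈ p → v ∈ q

  Disjoint : (p q : Fin n → Bool) → Set
  Disjoint p q = ∀ v → v ∈ p → v ∈ q → ⊥

  _∪_ : (p q : Fin n → Bool) → Fin n → Bool
  (p ∪ q) v = p v ∨ q v

  ∪-elim : ∀ p q {v} → v ∈ p ∪ q → v ∈ p ⊎ v ∈ q
  ∪-elim p q {v} h with p v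
  ... | true  = inj₁ refl
  ... | false = inj₂ h

  ∪-introˡ : ∀ p q {v} → v ∈ p → v ∈ p ∪ q
  ∪-introˡ p q {v} h = cong (_∨ q v) h

  ∪-introʳ : ∀ p q {v} → v ∈ q → v ∈ p ∪ q
  ∪-introʳ p q {v} h = trans (cong (p v ∨_) h) (∨-zeroʳ (p v))

-- Sums over `Fin n` and cardinalities of subsets

sum-mono-≤ : ∀ {n} {f g : Fin n → ℕ} → (∀ v → f v ≤ g v) → sum f ≤ sum g
sum-mono-≤ {zero}  h = z≤n
sum-mono-≤ {suc n} h = +-mono-≤ (h zero) (sum-mono-≤ (h ∘ suc))

sum-mono-< : ∀ {n} {f g : Fin n → ℕ} → (∀ v → f v ≤ g v) → ∀ v → f v < g v → sum f < sum g
sum-mono-< {suc n} h zero    l = +-mono-<-≤ l (sum-mono-≤ (h ∘ suc))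
sum-mono-< {suc n} h (suc v) l = +-mono-≤-< (h zero) (sum-mono-< (h ∘ suc) v l)

-- Turns cardinalities into sums of indicators, so that linearity and exchange of summation become
-- available.
count≡sum : ∀ {n} (p : Fin n → Bool) → count p ≡ sum (𝟙 ∘ p)
count≡sum {zero}  p = refl
count≡sum {suc n} p with p zero
... | true  = cong suc (count≡sum (p ∘ suc))
... | false = count≡sum (p ∘ suc)

module _ {n : ℕ} where

  private variable
    p q r : Fin n → Bool

  count-mono : p ⊆ q → count p ≤ count q
  count-mono {p} {q} h = subst₂ _≤_ (sym (count≡sum p)) (sym (count≡sum q)) (sum-mono-≤ 𝟙-mono)
    where
    𝟙-mono : ∀ v → 𝟙 (p v) ≤ 𝟙 (q v)
    𝟙-mono v with p v in e
    ... | false = z≤n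
    ... | true rewrite h v e = ≤-refl

  count-∪-≤ : ∀ p q → count {n} (p ∪ q) ≤ count p + count q
  count-∪-≤ p q = begin
    count (p ∪ q)                   ≡⟨ count≡sum (p ∪ q) ⟩
    sum (𝟙 ∘ (p ∪ q))               ≤⟨ sum-mono-≤ (λ v → 𝟙-∨ (p v) (q v)) ⟩
    sum (λ v → 𝟙 (p v) + 𝟙 (q v))   ≡⟨ ∑-distrib-+ (𝟙 ∘ p) (𝟙 ∘ q) ⟩
    sum (𝟙 ∘ p) + sum (𝟙 ∘ q)       ≡⟨ cong₂ _+_ (count≡sum p) (count≡sum q) ⟨
    count p + count q               ∎
    where
    open ≤-Reasoning
    𝟙-∨ : ∀ a b → 𝟙 (a ∨ b) ≤ 𝟙 a + 𝟙 b
    𝟙-∨ true  b = s≤s z≤n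
    𝟙-∨ false b = ≤-refl

  count-∪-disjoint : Disjoint p q → count p + count q ≤ count (p ∪ q)
  count-∪-disjoint {p} {q} dis = begin
    count p + count q               ≡⟨ cong₂ _+_ (count≡sum p) (count≡sum q) ⟩
    sum (𝟙 ∘ p) + sum (𝟙 ∘ q)       ≡⟨ ∑-distrib-+ (𝟙 ∘ p) (𝟙 ∘ q) ⟨
    sum (λ v → 𝟙 (p v) + 𝟙 (q v))   ≤⟨ sum-mono-≤ 𝟙-∨ ⟩
    sum (𝟙 ∘ (p ∪ q))               ≡⟨ count≡sum (p ∪ q) ⟨
    count (p ∪ q)                   ∎
    where
    open ≤-Reasoning
    𝟙-∨ : ∀ v → 𝟙 (p v) + 𝟙 (q v) ≤ 𝟙 (p v ∨ q v)
    𝟙-∨ v with p v in e | q v in e′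
    ... | true  | true  = ⊥-elim (dis v e e′)
    ... | true  | false = ≤-refl
    ... | false | _     = ≤-refl

  count-cover : r ⊆ p ∪ q → count r ≤ count p + count q
  count-cover {p = p} {q} h = ≤-trans (count-mono h) (count-∪-≤ p q)

  count-cover₃ : ∀ p₁ p₂ p₃ → r ⊆ p₁ ∪ p₂ ∪ p₃ → count r ≤ count p₁ + (count p₂ + count p₃)
  count-cover₃ p₁ p₂ p₃ h =
    ≤-trans (count-cover h) (+-monoʳ-≤ (count p₁) (count-∪-≤ p₂ p₃))

  count-disjoint : p ⊆ r → q ⊆ r → Disjoint p q → count p + count q ≤ count r
  count-disjoint {p = p} {q = q} p⊆r q⊆r dis = ≤-trans (count-∪-disjoint dis)
    (count-mono (λ v → [ p⊆r v , q⊆r v ] ∘ ∪-elim p q))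

  count-disjoint₃ : ∀ p₁ p₂ p₃ → p₁ ⊆ r → p₂ ⊆ r → p₃ ⊆ r →
    Disjoint p₁ p₂ → Disjoint p₁ p₃ → Disjoint p₂ p₃ → count p₁ + (count p₂ + count p₃) ≤ count r
  count-disjoint₃ p₁ p₂ p₃ s₁ s₂ s₃ d₁₂ d₁₃ d₂₃ =
    ≤-trans (+-monoʳ-≤ (count p₁) (count-∪-disjoint d₂₃))
      (count-disjoint s₁ (λ v → [ s₂ v , s₃ v ] ∘ ∪-elim p₂ p₃)
        (λ v h → [ d₁₂ v h , d₁₃ v h ] ∘ ∪-elim p₂ p₃))

  count-<⇒∃ : count p < count q → ∃ λ v → v ∈ q × p v ≡ false
  -- In the order `false < true`, `p v < q v` says that `v` lies in `q` but not in `p`; this is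
  -- decidable, so a search settles existence.
  count-<⇒∃ {p} {q} lt with any? (λ v → p v Bool.<? q v)
  ... | yes (v , h) = v , <-true h
    where
    <-true : ∀ {a b} → a Bool.< b → b ≡ true × a ≡ false
    <-true Bool.f<t = refl , refl
  ... | no ¬∃ = contradiction (count-mono q⊆p) (<⇒≱ lt)
    where
    q⊆p : q ⊆ p
    q⊆p v h with p v in e
    ... | true  = refl
    ... | false = ⊥-elim (¬∃ (v , subst₂ Bool._<_ (sym e) (sym h) Bool.f<t))

count-∅ : ∀ n → count {n} (λ _ → false) ≡ 0
count-∅ zero    = refl
count-∅ (suc n) = count-∅ n

⁅_⁆ : ∀ {n} → Fin n → Fin n → Bool
⁅ u ⁆ v = does (u ≟ v)

count-⁅⁆ : ∀ {n} (u : Fin n) → count ⁅ u ⁆ ≡ 1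
count-⁅⁆ {suc n} zero    = cong suc (count-∅ n)
count-⁅⁆ {suc n} (suc u) = count-⁅⁆ u

∈⁅⁆⇒≡ : ∀ {n} {u v : Fin n} → v ∈ ⁅ u ⁆ → u ≡ v
∈⁅⁆⇒≡ {u = u} {v} h with u ≟ v
... | yes e = e

u∈⁅u⁆ : ∀ {n} (u : Fin n) → u ∈ ⁅ u ⁆
u∈⁅u⁆ u = dec-true (u ≟ u) refl

count-positive : ∀ {n} (p : Fin n → Bool) → 0 < count p → ∃ λ v → v ∈ p
count-positive {n} p 0<p =
  let v , v∈p , _ = count-<⇒∃ {p = λ _ → false} {q = p} (subst (_< count p) (sym (count-∅ n)) 0<p)
  in v , v∈p

∈⇒count-positive : ∀ {n} (p : Fin n → Bool) {v} → v ∈ p → 0 < count p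
∈⇒count-positive p {v} v∈p = subst (_≤ count p) (count-⁅⁆ v)
  (count-mono {p = ⁅ v ⁆} {q = p} (λ w h → subst (_∈ p) (∈⁅⁆⇒≡ h) v∈p))

count-subsingleton : ∀ {n} {p : Fin n → Bool} → (∀ u v → u ∈ p → v ∈ p → u ≡ v) → count p ≤ 1
count-subsingleton {p = p} h with count p in e
... | zero  = z≤n
... | suc k with count-positive p (subst (0 <_) (sym e) (s≤s z≤n))
...   | v , v∈p = subst₂ _≤_ e (count-⁅⁆ v)
        (count-mono λ w w∈p → subst (_∈ ⁅ v ⁆) (h v w v∈p w∈p) (u∈⁅u⁆ v))

-- Both sides count the pairs `(v , w)` with `v ∈ P`, `w ∈ Q` and `B v w`. It serves for arcs inside
-- a tournament, for arcs from `Y` to `X`, and for second out-neighbours from `Y` to `X`.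
double-count : ∀ {n} (P Q : Fin n → Bool) (B : Fin n → Fin n → Bool) →
  sum (λ v → 𝟙 (P v) * count (λ w → Q w ∧ B v w)) ≡
  sum (λ w → 𝟙 (Q w) * count (λ v → P v ∧ B v w))
double-count P Q B = begin
  sum (λ v → 𝟙 (P v) * count (λ w → Q w ∧ B v w))       ≡⟨ sum-cong-≗ (λ v → expand (P v) (λ w → Q w ∧ B v w)) ⟩
  sum (λ v → sum (λ w → 𝟙 (P v) * 𝟙 (Q w ∧ B v w)))     ≡⟨ ∑-comm (λ v w → 𝟙 (P v) * 𝟙 (Q w ∧ B v w)) ⟩
  sum (λ w → sum (λ v → 𝟙 (P v) * 𝟙 (Q w ∧ B v w)))     ≡⟨ sum-cong-≗ (λ w → sum-cong-≗ (λ v → exchange (P v) (Q w) (B v w))) ⟩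
  sum (λ w → sum (λ v → 𝟙 (Q w) * 𝟙 (P v ∧ B v w)))     ≡⟨ sum-cong-≗ (λ w → expand (Q w) (λ v → P v ∧ B v w)) ⟨
  sum (λ w → 𝟙 (Q w) * count (λ v → P v ∧ B v w))       ∎
  where
  open ≡-Reasoning
  expand : ∀ b p → 𝟙 b * count p ≡ sum (λ w → 𝟙 b * 𝟙 (p w))
  expand b p = trans (cong (𝟙 b *_) (count≡sum p)) (*-distribˡ-sum (𝟙 b) (𝟙 ∘ p))
  exchange : ∀ a b c → 𝟙 a * 𝟙 (b ∧ c) ≡ 𝟙 b * 𝟙 (a ∧ c)
  exchange true  true  c = refl
  exchange true  false c = refl
  exchange false true  c = refl
  exchange false false c = refl

-- Tournaments

module Tournament {n : ℕ} (A : Digraph n) (R : Fin n → Bool)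
  (oriented : Oriented A) (tournament : TournamentOn A R) where

  degree-sum : ∀ v → v ∈ R → outdegIn A R v + (indegIn A R v + 1) ≡ count R
  degree-sum v v∈R = subst (λ k → outdegIn A R v + (indegIn A R v + k) ≡ count R) (count-⁅⁆ v)
    (≤-antisym
      (count-disjoint₃ out inn ⁅ v ⁆
        (λ w → ∧-conicalˡ (R w) _) (λ w → ∧-conicalˡ (R w) _)
        (λ w h → subst (_∈ R) (∈⁅⁆⇒≡ h) v∈R)
        (λ w h h′ → true≢false (∧-conicalʳ (R w) _ h′) (proj₂ oriented v w (∧-conicalʳ (R w) _ h)))
        (λ w h h′ → true≢false (∧-conicalʳ (R w) _ h)
          (subst (λ z → A v z ≡ false) (∈⁅⁆⇒≡ h′) (proj₁ oriented v)))
        (λ w h h′ → true≢false (∧-conicalʳ (R w) _ h)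
          (subst (λ z → A z v ≡ false) (∈⁅⁆⇒≡ h′) (proj₁ oriented v))))
      (count-cover₃ out inn ⁅ v ⁆ covered))
    where
    out inn : Fin n → Bool
    out w = R w ∧ A v w
    inn w = R w ∧ A w v
    covered : R ⊆ out ∪ inn ∪ ⁅ v ⁆
    covered w w∈R with bool-cases (⁅ v ⁆ w)
    ... | inj₁ w≡v = ∪-introʳ out (inn ∪ ⁅ v ⁆) (∪-introʳ inn ⁅ v ⁆ w≡v)
    ... | inj₂ w≢v with tournament v w v∈R w∈R (λ { refl → true≢false (u∈⁅u⁆ v) w≢v })
    ...   | inj₁ vw = ∪-introˡ out (inn ∪ ⁅ v ⁆) (cong₂ _∧_ w∈R vw)
    ...   | inj₂ wv = ∪-introʳ out (inn ∪ ⁅ v ⁆) (∪-introˡ inn ⁅ v ⁆ (cong₂ _∧_ w∈R wv))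

  sum-𝟙* : ∀ k → sum (λ v → 𝟙 (R v) * k) ≡ count R * k
  sum-𝟙* k = trans (sym (*-distribʳ-sum k (𝟙 ∘ R))) (cong (_* k) (sym (count≡sum R)))

  sum-outdeg≡sum-indeg :
    sum (λ v → 𝟙 (R v) * outdegIn A R v) ≡ sum (λ v → 𝟙 (R v) * indegIn A R v)
  sum-outdeg≡sum-indeg = double-count R R A

  -- Out-degree plus in-degree plus one is `count R` at each vertex, and the two degree sums agree.
  -- The form avoids subtraction and halving in r(r - 1)/2.
  sum-indeg : 2 * sum (λ v → 𝟙 (R v) * indegIn A R v) + count R ≡ count R * count R
  sum-indeg = begin
    2 * I + count R                      ≡⟨ cong₂ (λ s t → I + s + t) (+-identityʳ I) (sym (*-identityʳ (count R))) ⟩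
    I + I + count R * 1                  ≡⟨ cong₂ (λ s t → s + I + t) (sym sum-outdeg≡sum-indeg) (sym (sum-𝟙* 1)) ⟩
    O + I + sum (λ v → 𝟙 (R v) * 1)      ≡⟨ +-assoc O I _ ⟩
    O + (I + sum (λ v → 𝟙 (R v) * 1))    ≡⟨ cong (O +_) (∑-distrib-+ _ (λ v → 𝟙 (R v) * 1)) ⟨
    O + sum (λ v → 𝟙 (R v) * indegIn A R v + 𝟙 (R v) * 1)
                                         ≡⟨ ∑-distrib-+ (λ v → 𝟙 (R v) * outdegIn A R v) _ ⟨
    sum (λ v → 𝟙 (R v) * outdegIn A R v + (𝟙 (R v) * indegIn A R v + 𝟙 (R v) * 1))
                                         ≡⟨ sum-cong-≗ pointwise ⟩
    sum (λ v → 𝟙 (R v) * count R)        ≡⟨ sum-𝟙* (count R) ⟩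
    count R * count R                    ∎
    where
    open ≡-Reasoning
    O I : ℕ
    O = sum (λ v → 𝟙 (R v) * outdegIn A R v)
    I = sum (λ v → 𝟙 (R v) * indegIn A R v)
    pointwise : ∀ v → 𝟙 (R v) * outdegIn A R v + (𝟙 (R v) * indegIn A R v + 𝟙 (R v) * 1) ≡ 𝟙 (R v) * count R
    pointwise v with R v in e
    ... | false = refl
    ... | true  = trans (cong₂ _+_ (*-identityˡ (outdegIn A R v)) (cong (_+ 1) (*-identityˡ (indegIn A R v))))
                    (trans (degree-sum v e) (sym (*-identityˡ (count R))))

  -- In the applications `i` counts vertices outside `R` that dominate all of `R`, and `d` bounds
  -- the in-degrees in the ambient tournament.
  module Dominated (i d : ℕ) (bounded : ∀ v → v ∈ R → i + indegIn A R v ≤ d) where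

    private
      r : ℕ
      r = count R
      f g : Fin n → ℕ
      f v = 𝟙 (R v) * (i + indegIn A R v)
      g v = 𝟙 (R v) * d

      f≤g : ∀ v → f v ≤ g v
      f≤g v with R v in e
      ... | false = z≤n
      ... | true  = *-monoʳ-≤ 1 (bounded v e)

      sum-f : 2 * sum f + r ≡ r * (2 * i + r)
      sum-f = begin
        2 * sum f + r              ≡⟨ cong (λ s → 2 * s + r) split ⟩
        2 * (r * i + I) + r        ≡⟨ regroup r i I ⟩
        2 * (r * i) + (2 * I + r)  ≡⟨ cong (2 * (r * i) +_) sum-indeg ⟩
        2 * (r * i) + r * r        ≡⟨ factor r i ⟩
        r * (2 * i + r)            ∎
        where
        open ≡-Reasoning
        I : ℕ
        I = sum (λ v → 𝟙 (R v) * indegIn A R v)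
        split : sum f ≡ r * i + I
        split = trans (sum-cong-≗ (λ v → *-distribˡ-+ (𝟙 (R v)) i _))
          (trans (∑-distrib-+ (λ v → 𝟙 (R v) * i) _) (cong (_+ I) (sum-𝟙* i)))
        regroup : ∀ r i I → 2 * (r * i + I) + r ≡ 2 * (r * i) + (2 * I + r)
        regroup = solve-∀
        factor : ∀ r i → 2 * (r * i) + r * r ≡ r * (2 * i + r)
        factor = solve-∀

      sum-g : 2 * sum g + r ≡ r * suc (2 * d)
      sum-g = trans (cong (λ s → 2 * s + r) (sum-𝟙* d)) (factor r d)
        where
        factor : ∀ r d → 2 * (r * d) + r ≡ r * suc (2 * d)
        factor = solve-∀

    -- Summing `bounded` over `R` gives r·i + r(r - 1)/2 ≤ r·d. Dividing by r needs `R` nonempty.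
    dominated-size : 0 < r → 2 * i + r ≤ suc (2 * d)
    dominated-size 0<r = *-cancelˡ-≤ r {{>-nonZero 0<r}}
      (subst₂ _≤_ sum-f sum-g (+-monoˡ-≤ r (*-monoʳ-≤ 2 (sum-mono-≤ f≤g))))

    -- In the extremal case the two sums agree, so a strict inequality at a single vertex is
    -- impossible.
    dominated-tight : suc (2 * d) ≤ 2 * i + r → ∀ v → v ∈ R → d ≤ i + indegIn A R v
    dominated-tight tight v v∈R = ≮⇒≥ λ lt →
      <⇒≱ (sum-mono-< f≤g v (subst (λ b → 𝟙 b * (i + indegIn A R v) < 𝟙 b * d) (sym v∈R) (*-monoʳ-< 1 lt)))
        (*-cancelˡ-≤ 2 (+-cancelʳ-≤ r _ _ (subst₂ _≤_ (sym sum-g) (sym sum-f) (*-monoʳ-≤ r tight))))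

-- Second out-neighbourhoods, reversal and restriction

module _ {n : ℕ} (A : Digraph n) where

  existsB-intro : ∀ {m} (p : Fin m → Bool) w → p w ≡ true → existsB p ≡ true
  existsB-intro p zero    h = cong (_∨ existsB (p ∘ suc)) h
  existsB-intro p (suc w) h =
    trans (cong (p zero ∨_) (existsB-intro (p ∘ suc) w h)) (∨-zeroʳ (p zero))

  secondOutN-intro : ∀ {u w v} → A u w ≡ true → A w v ≡ true → A u v ≡ false → secondOutN A u v ≡ true
  secondOutN-intro {u} {w} {v} uw wv ¬uv =
    cong₂ _∧_ (existsB-intro (λ w → A u w ∧ A w v) w (cong₂ _∧_ uw wv)) (cong not ¬uv)

  no-path : ∀ {u w v} → A u v ≡ false → secondOutN A u v ≡ false → A u w ≡ true → A w v ≡ false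
  no-path {w = w} {v} ¬uv ¬uuv uw with bool-cases (A w v)
  ... | inj₂ ¬wv = ¬wv
  ... | inj₁ wv  = ⊥-elim (true≢false (secondOutN-intro uw wv ¬uv) ¬uuv)

Oriented-flip : ∀ {n} {A : Digraph n} → Oriented A → Oriented (flip A)
Oriented-flip (irreflexive , asymmetric) = irreflexive , λ u v → asymmetric v u

TournamentOn-flip : ∀ {n} {A : Digraph n} {R} → TournamentOn A R → TournamentOn (flip A) R
TournamentOn-flip t u v u∈R v∈R u≢v = swap (t u v u∈R v∈R u≢v)

TournamentOn-⊆ : ∀ {n} {A : Digraph n} {R S} → R ⊆ S → TournamentOn A S → TournamentOn A R
TournamentOn-⊆ R⊆S t u v u∈R v∈R = t u v (R⊆S u u∈R) (R⊆S v v∈R)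

-- Almost regular tournaments

module AlmostRegularTournament {n : ℕ} (A : Digraph n) (Y : Fin n → Bool) (d : ℕ)
  (oriented : Oriented A) (tournament : TournamentOn A Y)
  (almostRegular : AlmostRegularOn A Y) (|Y|≡2d : count Y ≡ 2 * d) where

  open Tournament A Y oriented tournament using (degree-sum; sum-𝟙*; sum-outdeg≡sum-indeg; sum-indeg)

  inY outY secY : Fin n → ℕ
  inY  = indegIn A Y
  outY = outdegIn A Y
  secY u = count (λ v → Y v ∧ secondOutN A u v)

  -- The two degrees add up to 2d - 1 and differ by one.
  degrees : ∀ {v} → v ∈ Y → (outY v ≡ d × suc (inY v) ≡ d) ⊎ (suc (outY v) ≡ d × inY v ≡ d)
  degrees {v} v∈Y with almostRegular v v∈Y | trans (degree-sum v v∈Y) |Y|≡2d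
  ... | inj₁ out≡ | total = inj₁ (trans out≡ in≡d , in≡d)
    where
    double : ∀ k → 2 * suc k ≡ suc k + (k + 1)
    double = solve-∀
    in≡d : suc (inY v) ≡ d
    in≡d = *-cancelˡ-≡ _ _ 2 (trans (double (inY v)) (trans (cong (_+ (inY v + 1)) (sym out≡)) total))
  ... | inj₂ in≡ | total = inj₂ (out≡d , trans in≡ out≡d)
    where
    double : ∀ k → 2 * suc k ≡ k + (suc k + 1)
    double = solve-∀
    out≡d : suc (outY v) ≡ d
    out≡d = *-cancelˡ-≡ _ _ 2 (trans (double (outY v)) (trans (cong (λ i → outY v + (i + 1)) (sym in≡)) total))

  outY≤d : ∀ {v} → v ∈ Y → outY v ≤ d
  outY≤d v∈Y with degrees v∈Y
  ... | inj₁ (o , _) = ≤-reflexive o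
  ... | inj₂ (o , _) = ≤-trans (n≤1+n _) (≤-reflexive o)

  inY≤d : ∀ {v} → v ∈ Y → inY v ≤ d
  inY≤d v∈Y with degrees v∈Y
  ... | inj₁ (_ , i) = ≤-trans (n≤1+n _) (≤-reflexive i)
  ... | inj₂ (_ , i) = ≤-reflexive i

  low : Fin n → Bool
  low v = Y v ∧ (outY v <ᵇ d)

  low⊆Y : low ⊆ Y
  low⊆Y v = ∧-conicalˡ (Y v) _

  low⇒outY<d : ∀ {v} → v ∈ low → outY v < d
  low⇒outY<d {v} h = <ᵇ-true⁻¹ (∧-conicalʳ (Y v) _ h)

  d≤inY⇒low : ∀ {v} → v ∈ Y → d ≤ inY v → v ∈ low
  d≤inY⇒low v∈Y d≤in with degrees v∈Y
  ... | inj₁ (_ , i) = ⊥-elim (<⇒≱ (≤-reflexive i) d≤in)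
  ... | inj₂ (o , _) = cong₂ _∧_ v∈Y (<ᵇ-true (≤-reflexive o))

  low-degrees : ∀ {v} → v ∈ low → suc (outY v) ≡ d × inY v ≡ d
  low-degrees {v} v∈low with degrees (low⊆Y v v∈low)
  ... | inj₁ (o , _) = ⊥-elim (<-irrefl o (low⇒outY<d v∈low))
  ... | inj₂ oi = oi

  high-degrees : ∀ {v} → v ∈ Y → low v ≡ false → outY v ≡ d × suc (inY v) ≡ d
  high-degrees v∈Y v∉low with degrees v∈Y
  ... | inj₁ oi = oi
  ... | inj₂ (_ , i) = ⊥-elim (true≢false (d≤inY⇒low v∈Y (≤-reflexive (sym i))) v∉low)

  -- The out-degrees add up to d(2d - 1), and each low vertex contributes one less than `d`; hence
  -- 2d·d exceeds the total by `count low`.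
  count-low : count low ≡ d
  count-low = +-cancelˡ-≡ O (count low) d (*-cancelˡ-≡ _ _ 2 (begin
    2 * (O + count low)    ≡⟨ cong (2 *_) sum-low ⟩
    2 * (count Y * d)      ≡⟨ cong (λ y → 2 * (y * d)) |Y|≡2d ⟩
    2 * (2 * d * d)        ≡⟨ square d ⟩
    2 * d * (2 * d)        ≡⟨ cong (λ y → y * y) |Y|≡2d ⟨
    count Y * count Y      ≡⟨ sum-indeg ⟨
    2 * I + count Y        ≡⟨ cong₂ (λ s t → 2 * s + t) (sym sum-outdeg≡sum-indeg) |Y|≡2d ⟩
    2 * O + 2 * d          ≡⟨ *-distribˡ-+ 2 O d ⟨
    2 * (O + d)            ∎))
    where
    open ≡-Reasoning
    O I : ℕ
    O = sum (λ v → 𝟙 (Y v) * outY v)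
    I = sum (λ v → 𝟙 (Y v) * inY v)
    square : ∀ d → 2 * (2 * d * d) ≡ 2 * d * (2 * d)
    square = solve-∀
    pointwise : ∀ v → 𝟙 (Y v) * outY v + 𝟙 (low v) ≡ 𝟙 (Y v) * d
    pointwise v with bool-cases (Y v) | bool-cases (low v)
    ... | inj₁ v∈Y | inj₁ v∈low =
          subst₂ (λ y l → 𝟙 y * outY v + 𝟙 l ≡ 𝟙 y * d) (sym v∈Y) (sym v∈low)
            (trans (+-comm (1 * outY v) 1) (trans (cong suc (*-identityˡ (outY v)))
              (trans (proj₁ (low-degrees v∈low)) (sym (*-identityˡ d)))))
    ... | inj₁ v∈Y | inj₂ v∉low =
          subst₂ (λ y l → 𝟙 y * outY v + 𝟙 l ≡ 𝟙 y * d) (sym v∈Y) (sym v∉low)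
            (trans (+-identityʳ (1 * outY v)) (cong (1 *_) (proj₁ (high-degrees v∈Y v∉low))))
    ... | inj₂ v∉Y | _ rewrite v∉Y = refl
    sum-low : O + count low ≡ count Y * d
    sum-low = trans (cong (O +_) (count≡sum low))
      (trans (sym (∑-distrib-+ (λ v → 𝟙 (Y v) * outY v) (𝟙 ∘ low)))
        (trans (sum-cong-≗ pointwise) (sum-𝟙* d)))

  -- In-neighbours missing from the second out-neighbourhood

  module _ {y v} (y∈Y : y ∈ Y) (v∈Y : v ∈ Y) (vy : A v y ≡ true) (¬yyv : secondOutN A y v ≡ false) where

    -- An arc from `w` to `v` would complete a two-step path from `y` to `v`.
    missed-dominates : ∀ w → w ∈ Y → A y w ≡ true → A v w ≡ true
    missed-dominates w w∈Y yw
      with tournament v w v∈Y w∈Y (λ { refl → true≢false yw (proj₂ oriented v y vy) })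
    ... | inj₁ vw = vw
    ... | inj₂ wv = ⊥-elim (true≢false wv (no-path A (proj₂ oriented v y vy) ¬yyv yw))

    -- Besides the out-neighbours of `y` in `Y`, `v` also dominates `y` itself.
    missed-outY : outY y < outY v
    missed-outY = subst (_≤ outY v) (trans (cong (outY y +_) (count-⁅⁆ y)) (+-comm (outY y) 1))
      (count-disjoint {p = λ w → Y w ∧ A y w} {r = λ w → Y w ∧ A v w} {q = ⁅ y ⁆}
        (λ w h → let w∈Y = ∧-conicalˡ (Y w) _ h in
          cong₂ _∧_ w∈Y (missed-dominates w w∈Y (∧-conicalʳ (Y w) _ h)))
        (λ w h → subst (λ w → Y w ∧ A v w ≡ true) (∈⁅⁆⇒≡ h) (cong₂ _∧_ y∈Y vy))
        (λ w h h′ → true≢false (∧-conicalʳ (Y w) _ h)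
          (subst (λ z → A y z ≡ false) (∈⁅⁆⇒≡ h′) (proj₁ oriented y))))

    -- The in-neighbour `v′` of `y` is a further out-neighbour of `v`, distinct from `y` and from
    -- the out-neighbours of `y`.
    missed-outY₂ : ∀ {v′} → v′ ∈ Y → A v′ y ≡ true → A v v′ ≡ true → suc (outY y) < outY v
    missed-outY₂ {v′} v′∈Y v′y vv′ = subst (_≤ outY v)
      (trans (cong₂ (λ s t → outY y + (s + t)) (count-⁅⁆ y) (count-⁅⁆ v′)) (+-comm (outY y) 2))
      (count-disjoint₃ {r = λ w → Y w ∧ A v w} (λ w → Y w ∧ A y w) ⁅ y ⁆ ⁅ v′ ⁆
        (λ w h → let w∈Y = ∧-conicalˡ (Y w) _ h in
          cong₂ _∧_ w∈Y (missed-dominates w w∈Y (∧-conicalʳ (Y w) _ h)))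
        (λ w h → subst (λ w → Y w ∧ A v w ≡ true) (∈⁅⁆⇒≡ h) (cong₂ _∧_ y∈Y vy))
        (λ w h → subst (λ w → Y w ∧ A v w ≡ true) (∈⁅⁆⇒≡ h) (cong₂ _∧_ v′∈Y vv′))
        (λ w h h′ → true≢false (∧-conicalʳ (Y w) _ h)
          (subst (λ z → A y z ≡ false) (∈⁅⁆⇒≡ h′) (proj₁ oriented y)))
        (λ w h h′ → true≢false (∧-conicalʳ (Y w) _ h)
          (subst (λ z → A y z ≡ false) (∈⁅⁆⇒≡ h′) (proj₂ oriented v′ y v′y)))
        (λ w h h′ → true≢false v′y
          (subst (λ z → A z y ≡ false) (trans (∈⁅⁆⇒≡ h) (sym (∈⁅⁆⇒≡ h′))) (proj₁ oriented y))))

  inY≤secY : ∀ {y} → (∀ v → v ∈ Y → A v y ≡ true → secondOutN A y v ≡ false → ⊥) → inY y ≤ secY y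
  inY≤secY {y} none = count-mono {p = λ v → Y v ∧ A v y} {q = λ v → Y v ∧ secondOutN A y v} included
    where
    included : (λ v → Y v ∧ A v y) ⊆ (λ v → Y v ∧ secondOutN A y v)
    included v h with bool-cases (secondOutN A y v)
    ... | inj₁ yyv = cong₂ _∧_ (∧-conicalˡ (Y v) _ h) yyv
    ... | inj₂ ¬yyv = ⊥-elim (none v (∧-conicalˡ (Y v) _ h) (∧-conicalʳ (Y v) _ h) ¬yyv)

  -- A missed in-neighbour would have out-degree above `d`.
  high-inY≤secY : ∀ {y} → y ∈ Y → low y ≡ false → inY y ≤ secY y
  high-inY≤secY y∈Y y∉low = inY≤secY λ v v∈Y vy ¬yyv →
    <⇒≱ (missed-outY y∈Y v∈Y vy ¬yyv)
      (subst (outY v ≤_) (sym (proj₁ (high-degrees y∈Y y∉low))) (outY≤d v∈Y))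

  -- Two missed in-neighbours would be joined by an arc, whose tail would have out-degree at least
  -- (d - 1) + 2 by `missed-outY₂`. So at most one is missed.
  low-inY≤1+secY : ∀ {y} → y ∈ low → inY y ≤ suc (secY y)
  low-inY≤1+secY {y} y∈low = begin
    inY y                    ≤⟨ count-cover {p = λ v → Y v ∧ secondOutN A y v} {q = missed} covered ⟩
    secY y + count missed    ≤⟨ +-monoʳ-≤ (secY y) (count-subsingleton unique) ⟩
    secY y + 1               ≡⟨ +-comm (secY y) 1 ⟩
    suc (secY y)             ∎
    where
    open ≤-Reasoning
    y∈Y : y ∈ Y
    y∈Y = low⊆Y y y∈low
    missed : Fin n → Bool
    missed v = Y v ∧ (A v y ∧ not (secondOutN A y v))
    covered : (λ v → Y v ∧ A v y) ⊆ (λ v → Y v ∧ secondOutN A y v) ∪ missed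
    covered v h with Y v | A v y | secondOutN A y v
    ... | true | true | true  = refl
    ... | true | true | false = refl
    no-arc : ∀ u v → u ∈ missed → v ∈ missed → A u v ≡ true → ⊥
    no-arc u v hu hv uv = <⇒≱ (missed-outY₂ y∈Y u∈Y uy ¬yyu (∧-conicalˡ (Y v) _ hv)
        (∧-conicalˡ (A v y) _ (∧-conicalʳ (Y v) _ hv)) uv)
      (subst (outY u ≤_) (sym (proj₁ (low-degrees y∈low))) (outY≤d u∈Y))
      where
      u∈Y : u ∈ Y
      u∈Y = ∧-conicalˡ (Y u) _ hu
      uy : A u y ≡ true
      uy = ∧-conicalˡ (A u y) _ (∧-conicalʳ (Y u) _ hu)
      ¬yyu : secondOutN A y u ≡ false
      ¬yyu = not-true (∧-conicalʳ (A u y) _ (∧-conicalʳ (Y u) _ hu))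
    unique : ∀ u v → u ∈ missed → v ∈ missed → u ≡ v
    unique u v hu hv with u ≟ v
    ... | yes u≡v = u≡v
    ... | no u≢v with tournament u v (∧-conicalˡ (Y u) _ hu) (∧-conicalˡ (Y v) _ hv) u≢v
    ...   | inj₁ uv = ⊥-elim (no-arc u v hu hv uv)
    ...   | inj₂ vu = ⊥-elim (no-arc v u hv hu vu)

-- Oriented split graphs without a Seymour vertex

module NoSeymourVertex {n : ℕ} (A : Digraph n) (Y : Fin n → Bool) (d : ℕ)
  (oriented : Oriented A) (independent : IndependentX A Y) (tournament : TournamentOn A Y)
  (almostRegular : AlmostRegularOn A Y) (|Y|≡2d : count Y ≡ 2 * d)
  (noSeymour : ∀ u → secondOutdeg A u < outdeg A u) where

  open AlmostRegularTournament A Y d oriented tournament almostRegular |Y|≡2d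

  X : Fin n → Bool
  X x = not (Y x)

  -- `secIn u` is |N⁻⁻(u) ∩ Y|.
  outX secX secIn : Fin n → ℕ
  outX u = count (λ x → X x ∧ A u x)
  secX u = count (λ x → X x ∧ secondOutN A u x)
  secIn u = count (λ y → Y y ∧ secondOutN A y u)

  -- The failure of the Seymour condition, split along `Y` and `X`.
  sec<out : ∀ u → secY u + secX u < outY u + outX u
  sec<out u = begin-strict
    secY u + secX u   ≤⟨ count-disjoint {p = λ v → Y v ∧ secondOutN A u v}
                           {r = secondOutN A u} {q = λ v → X v ∧ secondOutN A u v}
                           (λ v → ∧-conicalʳ (Y v) _) (λ v → ∧-conicalʳ (X v) _)
                           (λ v h h′ → true≢false (∧-conicalˡ (Y v) _ h) (not-true (∧-conicalˡ (X v) _ h′))) ⟩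
    secondOutdeg A u  <⟨ noSeymour u ⟩
    outdeg A u        ≤⟨ count-cover {r = A u} {p = λ v → Y v ∧ A u v} {q = λ v → X v ∧ A u v} covered ⟩
    outY u + outX u   ∎
    where
    open ≤-Reasoning
    covered : A u ⊆ (λ v → Y v ∧ A u v) ∪ (λ v → X v ∧ A u v)
    covered v uv with Y v
    ... | true  = cong (_∨ false) uv
    ... | false = uv

  -- A vertex of `X` and the vertices of `Y` it reaches

  module _ {x} (x∉Y : Y x ≡ false) where

    arc-from-X : ∀ {w} → A x w ≡ true → w ∈ Y
    arc-from-X {w} xw with bool-cases (Y w)
    ... | inj₁ w∈Y = w∈Y
    ... | inj₂ w∉Y = ⊥-elim (true≢false xw (independent x w x∉Y w∉Y))

    arc-to-X : ∀ {w} → A w x ≡ true → w ∈ Y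
    arc-to-X {w} wx with bool-cases (Y w)
    ... | inj₁ w∈Y = w∈Y
    ... | inj₂ w∉Y = ⊥-elim (true≢false wx (independent w x w∉Y x∉Y))

    outX≡0 : outX x ≡ 0
    outX≡0 = n≤0⇒n≡0 (subst (outX x ≤_) (count-∅ n)
      (count-mono {p = λ w → X w ∧ A x w} {q = λ _ → false} λ w h →
        ⊥-elim (true≢false (arc-from-X (∧-conicalʳ (X w) _ h)) (not-true (∧-conicalˡ (X w) _ h)))))

    secYX<outY : secY x + secX x < outY x
    secYX<outY = subst (secY x + secX x <_) (trans (cong (outY x +_) outX≡0) (+-identityʳ (outY x))) (sec<out x)

    -- Since `X` is independent, the end of a two-step path from `x` through `y` into `X` is never
    -- an out-neighbour of `x`.
    outX≤secX : ∀ {y} → A x y ≡ true → outX y ≤ secX x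
    outX≤secX {y} xy = count-mono {p = λ w → X w ∧ A y w} {q = λ w → X w ∧ secondOutN A x w}
      λ w h → let w∈X = ∧-conicalˡ (X w) _ h in
        cong₂ _∧_ w∈X (secondOutN-intro A xy (∧-conicalʳ (X w) _ h) (independent x w x∉Y (not-true w∈X)))

    unreached : Fin n → Bool
    unreached v = Y v ∧ (not (A x v) ∧ not (secondOutN A x v))

    unreached-elim : ∀ {v} → v ∈ unreached → v ∈ Y × A x v ≡ false × secondOutN A x v ≡ false
    unreached-elim {v} h = ∧-conicalˡ (Y v) _ h
      , not-true (∧-conicalˡ (not (A x v)) _ (∧-conicalʳ (Y v) _ h))
      , not-true (∧-conicalʳ (not (A x v)) _ (∧-conicalʳ (Y v) _ h))

    -- An arc from N⁺(x) to `v` would reach `v` in two steps, so `v` dominates all of N⁺(x), which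
    -- is disjoint from `unreached`.
    unreached-dominates : ∀ {v} → v ∈ unreached → outY x + outdegIn A unreached v ≤ outY v
    unreached-dominates {v} v∈U = let v∈Y , ¬xv , ¬xxv = unreached-elim v∈U in
      count-disjoint {p = λ w → Y w ∧ A x w} {r = λ w → Y w ∧ A v w} {q = λ w → unreached w ∧ A v w}
        (λ w h → cong₂ _∧_ (∧-conicalˡ (Y w) _ h)
          (dominates v∈Y ¬xv ¬xxv w (∧-conicalˡ (Y w) _ h) (∧-conicalʳ (Y w) _ h)))
        (λ w h → cong₂ _∧_ (proj₁ (unreached-elim (∧-conicalˡ (unreached w) _ h))) (∧-conicalʳ (unreached w) _ h))
        (λ w h h′ → true≢false (∧-conicalʳ (Y w) _ h)
          (proj₁ (proj₂ (unreached-elim (∧-conicalˡ (unreached w) _ h′)))))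
      where
      dominates : v ∈ Y → A x v ≡ false → secondOutN A x v ≡ false →
        ∀ w → w ∈ Y → A x w ≡ true → A v w ≡ true
      dominates v∈Y ¬xv ¬xxv w w∈Y xw with tournament v w v∈Y w∈Y (λ { refl → true≢false xw ¬xv })
      ... | inj₁ vw = vw
      ... | inj₂ wv = ⊥-elim (true≢false wv (no-path A ¬xv ¬xxv xw))

    -- N⁺(x), N⁺⁺(x) ∩ Y and `unreached` cover `Y`, and `secYX<outY` bounds the middle set by
    -- `outY x` - 1 - `secX x`.
    unreached-bound : suc (2 * d) + secX x ≤ 2 * outY x + count unreached
    unreached-bound = arith (outY x) (secY x) (count unreached) (secX x)
      (subst (_≤ outY x + (secY x + count unreached)) |Y|≡2d
        (count-cover₃ (λ v → Y v ∧ A x v) (λ v → Y v ∧ secondOutN A x v) unreached covered))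
      secYX<outY
      where
      covered : Y ⊆ (λ v → Y v ∧ A x v) ∪ (λ v → Y v ∧ secondOutN A x v) ∪ unreached
      covered v v∈Y rewrite v∈Y with A x v | secondOutN A x v
      ... | true  | _     = refl
      ... | false | true  = refl
      ... | false | false = refl
      arith : ∀ s t u b → 2 * d ≤ s + (t + u) → t + b < s → suc (2 * d) + b ≤ 2 * s + u
      arith s t u b h k = +-cancelˡ-≤ t _ _ (subst₂ _≤_ (lhs t b d) (rhs s t u) (+-mono-≤ k h))
        where
        lhs : ∀ t b d → suc (t + b) + 2 * d ≡ t + (suc (2 * d) + b)
        lhs = solve-∀
        rhs : ∀ s t u → s + (s + (t + u)) ≡ t + (2 * s + u)
        rhs = solve-∀

    -- Otherwise unreached has maximal size, and neither N⁺(x) nor unreached meets low: too many high vertices.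
    unreached-empty : ¬ (0 < count unreached)
    unreached-empty 0<u = arith (outY x) (count unreached) (secX x) unreached-bound
      (subst₂ (λ l y → outY x + (count unreached + l) ≤ y) count-low |Y|≡2d
        (count-disjoint₃ (λ v → Y v ∧ A x v) unreached low
          (λ v → ∧-conicalˡ (Y v) _) (λ v → proj₁ ∘ unreached-elim) low⊆Y
          (λ v h h′ → true≢false (∧-conicalʳ (Y v) _ h) (proj₁ (proj₂ (unreached-elim h′))))
          (λ v h → out-high (∧-conicalʳ (Y v) _ h))
          (λ v → unreached-high)))
      where
      -- `Dominated` speaks of in-degrees; reversing all arcs turns it into a bound for sets that
      -- dominate a common set, here N⁺(x).
      open Tournament (flip A) unreached (Oriented-flip {A = A} oriented)
        (TournamentOn-flip {A = A} {unreached} (TournamentOn-⊆ {A = A} {unreached} {Y} (λ v → proj₁ ∘ unreached-elim) tournament))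
      open Dominated (outY x) d
        (λ v v∈U → ≤-trans (unreached-dominates v∈U) (outY≤d (proj₁ (unreached-elim v∈U))))

      -- `unreached-bound` and `dominated-size` squeeze 2 `outY x` + `count unreached` to 2d + 1,
      -- leaving no room for `secX x`.
      secX≡0 : secX x ≡ 0
      secX≡0 = n≤0⇒n≡0 (+-cancelˡ-≤ (suc (2 * d)) _ _
        (≤-trans unreached-bound (subst (2 * outY x + count unreached ≤_) (sym (+-identityʳ _)) (dominated-size 0<u))))

      unreached-high : ∀ {v} → v ∈ unreached → v ∈ low → ⊥
      unreached-high {v} v∈U v∈low = <⇒≱ (low⇒outY<d v∈low)
        (≤-trans (dominated-tight (≤-trans (m≤m+n _ (secX x)) unreached-bound) v v∈U) (unreached-dominates v∈U))

      -- A low out-neighbour `y` of `x` would be a Seymour vertex: it has no out-neighbour in `X`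
      -- because `secX x` is 0, and within `Y` it misses at most one of its `d` in-neighbours.
      out-high : ∀ {y} → A x y ≡ true → y ∈ low → ⊥
      out-high {y} xy y∈low = <⇒≱ (sec<out y) (begin
        outY y + outX y   ≤⟨ +-mono-≤ outY≤secY (≤-trans (outX≤secX xy) (≤-trans (≤-reflexive secX≡0) z≤n)) ⟩
        secY y + secX y   ∎)
        where
        open ≤-Reasoning
        outY≤secY : outY y ≤ secY y
        outY≤secY = ≤-pred (subst (_≤ suc (secY y))
          (trans (proj₂ (low-degrees y∈low)) (sym (proj₁ (low-degrees y∈low)))) (low-inY≤1+secY y∈low))

      arith : ∀ s u b → suc (2 * d) + b ≤ 2 * s + u → s + (u + d) ≤ 2 * d → ⊥
      arith s u b h k = m+1+n≰m (4 * d) (begin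
        4 * d + suc (b + u)                      ≡⟨ lhs d b u ⟩
        suc (2 * d) + b + (u + 2 * d)            ≤⟨ +-monoˡ-≤ (u + 2 * d) h ⟩
        2 * s + u + (u + 2 * d)                  ≡⟨ mid s u d ⟩
        2 * (s + (u + d))                        ≤⟨ *-monoʳ-≤ 2 k ⟩
        2 * (2 * d)                              ≡⟨ *-assoc 2 2 d ⟨
        4 * d                                    ∎)
        where
        open ≤-Reasoning
        lhs : ∀ d b u → 4 * d + suc (b + u) ≡ suc (2 * d) + b + (u + 2 * d)
        lhs = solve-∀
        mid : ∀ s u d → 2 * s + u + (u + 2 * d) ≡ 2 * (s + (u + d))
        mid = solve-∀

    outY-bound : suc (2 * d) + secX x ≤ 2 * outY x
    outY-bound = subst (suc (2 * d) + secX x ≤_)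
      (trans (cong (2 * outY x +_) (n≤0⇒n≡0 (≮⇒≥ unreached-empty))) (+-identityʳ _)) unreached-bound

    outY+inY≤2d : outY x + inY x ≤ 2 * d
    outY+inY≤2d = subst (outY x + inY x ≤_) |Y|≡2d
      (count-disjoint {p = λ v → Y v ∧ A x v} {r = Y} {q = λ v → Y v ∧ A v x}
        (λ v → ∧-conicalˡ (Y v) _) (λ v → ∧-conicalˡ (Y v) _)
        (λ v h h′ → true≢false (∧-conicalʳ (Y v) _ h′) (proj₂ oriented x v (∧-conicalʳ (Y v) _ h))))

    -- N⁺(x) and N⁻(x) are disjoint in `Y`, so the excess of `outY x` over `d` is a deficit of
    -- `inY x`.
    inY-bound : suc (secX x) + 2 * inY x ≤ 2 * d
    inY-bound = +-cancelˡ-≤ (2 * d) _ _ (begin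
      2 * d + (suc (secX x) + 2 * inY x)      ≡⟨ lhs d (secX x) (inY x) ⟩
      suc (2 * d) + secX x + 2 * inY x        ≤⟨ +-monoˡ-≤ (2 * inY x) outY-bound ⟩
      2 * outY x + 2 * inY x                  ≡⟨ *-distribˡ-+ 2 (outY x) (inY x) ⟨
      2 * (outY x + inY x)                    ≤⟨ *-monoʳ-≤ 2 outY+inY≤2d ⟩
      2 * (2 * d)                             ≡⟨ cong (2 * d +_) (+-identityʳ (2 * d)) ⟩
      2 * d + 2 * d                           ∎)
      where
      open ≤-Reasoning
      lhs : ∀ d b i → 2 * d + (suc b + 2 * i) ≡ suc (2 * d) + b + 2 * i
      lhs = solve-∀

    2*inY<2d : 2 * inY x < 2 * d
    2*inY<2d = ≤-trans (s≤s (m≤n+m (2 * inY x) (secX x))) inY-bound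

    inY<d : inY x < d
    inY<d = *-cancelˡ-< 2 _ _ 2*inY<2d

    -- The vertices of `Y` that do not reach `x` in two steps

    unreaching : Fin n → Bool
    unreaching v = Y v ∧ (not (A v x) ∧ not (secondOutN A v x))

    unreaching-elim : ∀ {v} → v ∈ unreaching → v ∈ Y × A v x ≡ false × secondOutN A v x ≡ false
    unreaching-elim {v} h = ∧-conicalˡ (Y v) _ h
      , not-true (∧-conicalˡ (not (A v x)) _ (∧-conicalʳ (Y v) _ h))
      , not-true (∧-conicalʳ (not (A v x)) _ (∧-conicalʳ (Y v) _ h))

    -- The reverse arc would give a two-step path from `v` through `w` to `x`.
    arc-to-unreaching : ∀ {w v} → v ∈ unreaching → A w x ≡ true → A w v ≡ true
    arc-to-unreaching {w} {v} v∈W wx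
      with unreaching-elim v∈W
    ... | v∈Y , ¬vx , ¬vvx with tournament w v (arc-to-X wx) v∈Y (λ { refl → true≢false wx ¬vx })
    ...   | inj₁ wv = wv
    ...   | inj₂ vw = ⊥-elim (true≢false wx (no-path A ¬vx ¬vvx vw))

    unreaching-dominated : ∀ {v} → v ∈ unreaching → inY x + indegIn A unreaching v ≤ inY v
    unreaching-dominated {v} v∈W =
      count-disjoint {p = λ w → Y w ∧ A w x} {r = λ w → Y w ∧ A w v} {q = λ w → unreaching w ∧ A w v}
        (λ w h → cong₂ _∧_ (∧-conicalˡ (Y w) _ h) (arc-to-unreaching v∈W (∧-conicalʳ (Y w) _ h)))
        (λ w h → cong₂ _∧_ (proj₁ (unreaching-elim (∧-conicalˡ (unreaching w) _ h))) (∧-conicalʳ (unreaching w) _ h))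
        (λ w h h′ → true≢false (∧-conicalʳ (Y w) _ h)
          (proj₁ (proj₂ (unreaching-elim (∧-conicalˡ (unreaching w) _ h′)))))

    unreaching-cover : 2 * d ≤ inY x + (secIn x + count unreaching)
    unreaching-cover = subst (_≤ inY x + (secIn x + count unreaching)) |Y|≡2d
      (count-cover₃ (λ v → Y v ∧ A v x) (λ v → Y v ∧ secondOutN A v x) unreaching covered)
      where
      covered : Y ⊆ (λ v → Y v ∧ A v x) ∪ (λ v → Y v ∧ secondOutN A v x) ∪ unreaching
      covered v v∈Y rewrite v∈Y with A v x | secondOutN A v x
      ... | true  | _     = refl
      ... | false | true  = refl
      ... | false | false = refl

    private
      module W = Tournament A unreaching oriented
        (TournamentOn-⊆ {A = A} {unreaching} {Y} (λ v → proj₁ ∘ unreaching-elim) tournament)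
      module WD = W.Dominated (inY x) d
        (λ v v∈W → ≤-trans (unreaching-dominated v∈W) (inY≤d (proj₁ (unreaching-elim v∈W))))

    unreaching-empty⇒ : count unreaching ≡ 0 → inY x ≤ secIn x
    unreaching-empty⇒ w≡0 = +-cancelˡ-≤ (inY x) _ _ (begin
      inY x + inY x                          ≡⟨ cong (inY x +_) (+-identityʳ (inY x)) ⟨
      2 * inY x                              ≤⟨ <⇒≤ 2*inY<2d ⟩
      2 * d                                  ≤⟨ unreaching-cover ⟩
      inY x + (secIn x + count unreaching)    ≡⟨ cong (λ w → inY x + (secIn x + w)) w≡0 ⟩
      inY x + (secIn x + 0)                   ≡⟨ cong (inY x +_) (+-identityʳ (secIn x)) ⟩
      inY x + secIn x                         ∎)
      where open ≤-Reasoning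

    -- Compare 2 `inY x` + `count unreaching` ≤ 2d + 1 from `dominated-size` with the cover of `Y`
    -- by N⁻(x), N⁻⁻(x) and `unreaching`. The empty case is separate because `dominated-size`
    -- excludes it.
    inY≤1+secIn : inY x ≤ suc (secIn x)
    inY≤1+secIn with count unreaching in w≡
    ... | zero  = ≤-trans (unreaching-empty⇒ w≡) (n≤1+n _)
    ... | suc _ = +-cancelʳ-≤ (inY x + count unreaching) _ _ (begin
      inY x + (inY x + count unreaching)         ≡⟨ lhs (inY x) (count unreaching) ⟩
      2 * inY x + count unreaching               ≤⟨ WD.dominated-size (subst (0 <_) (sym w≡) (s≤s z≤n)) ⟩
      suc (2 * d)                                ≤⟨ s≤s unreaching-cover ⟩
      suc (inY x + (secIn x + count unreaching))  ≡⟨ rhs (inY x) (secIn x) (count unreaching) ⟩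
      suc (secIn x) + (inY x + count unreaching)  ∎)
      where
      open ≤-Reasoning
      lhs : ∀ i w → i + (i + w) ≡ 2 * i + w
      lhs = solve-∀
      rhs : ∀ i g w → suc (i + (g + w)) ≡ suc g + (i + w)
      rhs = solve-∀

    module Exceptional (secIn<inY : secIn x < inY x) where

      -- This is the extremal case of `dominated-size`, so `dominated-tight` becomes applicable.
      unreaching-size : suc (2 * d) ≤ 2 * inY x + count unreaching
      unreaching-size = begin
        suc (2 * d)                                ≤⟨ s≤s unreaching-cover ⟩
        suc (inY x + (secIn x + count unreaching))  ≡⟨ +-suc (inY x) _ ⟨
        inY x + (suc (secIn x) + count unreaching)  ≤⟨ +-monoʳ-≤ (inY x) (+-monoˡ-≤ (count unreaching) secIn<inY) ⟩
        inY x + (inY x + count unreaching)         ≡⟨ lhs (inY x) (count unreaching) ⟩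
        2 * inY x + count unreaching               ∎
        where
        open ≤-Reasoning
        lhs : ∀ i w → i + (i + w) ≡ 2 * i + w
        lhs = solve-∀

      unreaching-tight : ∀ {v} → v ∈ unreaching → d ≤ inY x + indegIn A unreaching v
      unreaching-tight {v} = WD.dominated-tight unreaching-size v

      unreaching⊆low : unreaching ⊆ low
      unreaching⊆low v v∈W = d≤inY⇒low (proj₁ (unreaching-elim v∈W))
        (≤-trans (unreaching-tight v∈W) (unreaching-dominated v∈W))

      -- By tightness N⁻(x) and the in-neighbours of `y` in `unreaching` already account for `d`
      -- in-neighbours of `y`; one more would exceed `inY≤d`.
      arc-into-unreaching : ∀ {v y} → y ∈ unreaching → v ∈ Y → A v y ≡ true → A v x ≡ false → v ∈ unreaching
      arc-into-unreaching {v} {y} y∈W v∈Y vy ¬vx with bool-cases (unreaching v)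
      ... | inj₁ v∈W = v∈W
      ... | inj₂ v∉W = ⊥-elim (<⇒≱ (≤-trans (s≤s (unreaching-tight y∈W)) (subst (_≤ inY y) count-extra
            (count-disjoint₃ {r = λ w → Y w ∧ A w y} ⁅ v ⁆ (λ w → Y w ∧ A w x) (λ w → unreaching w ∧ A w y)
              (λ w h → subst (λ w → Y w ∧ A w y ≡ true) (∈⁅⁆⇒≡ h) (cong₂ _∧_ v∈Y vy))
              (λ w h → cong₂ _∧_ (∧-conicalˡ (Y w) _ h) (arc-to-unreaching y∈W (∧-conicalʳ (Y w) _ h)))
              (λ w h → cong₂ _∧_ (proj₁ (unreaching-elim (∧-conicalˡ (unreaching w) _ h))) (∧-conicalʳ (unreaching w) _ h))
              (λ w h h′ → true≢false (∧-conicalʳ (Y w) _ h′) (subst (λ w → A w x ≡ false) (∈⁅⁆⇒≡ h) ¬vx))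
              (λ w h h′ → true≢false (∧-conicalˡ (unreaching w) _ h′) (subst (λ w → unreaching w ≡ false) (∈⁅⁆⇒≡ h) v∉W))
              (λ w h h′ → true≢false (∧-conicalʳ (Y w) _ h)
                (proj₁ (proj₂ (unreaching-elim (∧-conicalˡ (unreaching w) _ h′)))))))) (inY≤d (proj₁ (unreaching-elim y∈W))))
        where
        count-extra : count ⁅ v ⁆ + (inY x + indegIn A unreaching y) ≡ suc (inY x + indegIn A unreaching y)
        count-extra = cong (_+ (inY x + indegIn A unreaching y)) (count-⁅⁆ v)

      unreaching-full : ∀ y → y ∈ unreaching → inY y ≤ secY y
      unreaching-full y y∈W = inY≤secY none
        where
        y∈low : y ∈ low
        y∈low = unreaching⊆low y y∈W
        y∈Y : y ∈ Y
        y∈Y = low⊆Y y y∈low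
        none : ∀ v → v ∈ Y → A v y ≡ true → secondOutN A y v ≡ false → ⊥
        none v v∈Y vy ¬yyv with bool-cases (A v x)
        -- Such a `v` lies in `unreaching`, hence in `low`, while a missed in-neighbour has
        -- out-degree at least `d`.
        ... | inj₂ ¬vx = <-irrefl refl (≤-trans (s≤s d≤outY) (low⇒outY<d (unreaching⊆low v (arc-into-unreaching y∈W v∈Y vy ¬vx))))
          where
          d≤outY : d ≤ outY v
          d≤outY = subst (_≤ outY v) (proj₁ (low-degrees y∈low)) (missed-outY y∈Y v∈Y vy ¬yyv)
        -- Now `v` dominates every vertex of `Y` outside N⁻(x), so `Y` would have fewer than 2d
        -- vertices.
        ... | inj₁ vx = <⇒≱ (+-mono-≤-< (outY≤d v∈Y) inY<d) (begin
          d + d            ≡⟨ cong (d +_) (+-identityʳ d) ⟨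
          2 * d            ≡⟨ |Y|≡2d ⟨
          count Y          ≤⟨ count-cover {p = λ w → Y w ∧ A v w} {q = λ w → Y w ∧ A w x} covered ⟩
          outY v + inY x   ∎)
          where
          open ≤-Reasoning
          vw : ∀ w → w ∈ Y → A w x ≡ false → A v w ≡ true
          vw w w∈Y ¬wx with bool-cases (unreaching w)
          ... | inj₁ w∈W = arc-to-unreaching w∈W vx
          -- The arc between `y` and `w` must leave `y`, as otherwise `w` would belong to
          -- `unreaching`.
          ... | inj₂ w∉W with tournament y w y∈Y w∈Y (λ { refl → true≢false y∈W w∉W })
          ...   | inj₁ yw = missed-dominates y∈Y v∈Y vy ¬yyv w w∈Y yw
          ...   | inj₂ wy = ⊥-elim (true≢false (arc-into-unreaching y∈W w∈Y wy ¬wx) w∉W)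
          covered : Y ⊆ (λ w → Y w ∧ A v w) ∪ (λ w → Y w ∧ A w x)
          covered w w∈Y with bool-cases (A w x)
          ... | inj₁ wx  = ∪-introʳ (λ w → Y w ∧ A v w) (λ w → Y w ∧ A w x) (cong₂ _∧_ w∈Y wx)
          ... | inj₂ ¬wx = ∪-introˡ (λ w → Y w ∧ A v w) (λ w → Y w ∧ A w x) (cong₂ _∧_ w∈Y (vw w w∈Y ¬wx))

  -- Exceptional vertices and the double count

  exceptional : Fin n → Bool
  exceptional x = X x ∧ (secIn x <ᵇ inY x)

  exceptional-elim : ∀ {x} → x ∈ exceptional → Y x ≡ false × secIn x < inY x
  exceptional-elim {x} h = not-true (∧-conicalˡ (X x) _ h) , <ᵇ-true⁻¹ (∧-conicalʳ (X x) _ h)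

  -- Used with `s`, `b`, `o`, `a` equal to `secY`, `secX`, `outY`, `outX` of one vertex: what it
  -- gains inside `Y` must be outweighed by a surplus in `X`.
  gap : ∀ {s b o a} k → s + b < o + a → k + o ≤ suc s → b + k ≤ a
  gap {s} {b} {o} {a} k h h′ = +-cancelˡ-≤ o _ _ (begin
    o + (b + k)   ≡⟨ lhs o b k ⟩
    k + o + b     ≤⟨ +-monoˡ-≤ b h′ ⟩
    suc s + b     ≤⟨ h ⟩
    o + a         ∎)
    where
    open ≤-Reasoning
    lhs : ∀ o b k → o + (b + k) ≡ k + o + b
    lhs = solve-∀

  high-secX≤outX : ∀ {y} → y ∈ Y → low y ≡ false → secX y ≤ outX y
  high-secX≤outX {y} y∈Y y∉low = subst (_≤ outX y) (+-identityʳ (secX y))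
    (gap 0 (sec<out y) (subst (_≤ suc (secY y)) (trans (proj₂ oi) (sym (proj₁ oi))) (s≤s (high-inY≤secY y∈Y y∉low))))
    where oi = high-degrees y∈Y y∉low

  -- Compare the arcs from `Y` to `X` with the second-neighbour pairs from `Y` to `X`. Seen from
  -- `Y`, the arcs are ahead by at least one per low vertex and one more per vertex of `F`; seen
  -- from `X`, by at most one per exceptional vertex.
  exceptional-count : ∀ F → F ⊆ low → (∀ y → y ∈ F → inY y ≤ secY y) → d + count F ≤ count exceptional
  exceptional-count F F⊆low full = +-cancelˡ-≤ (sum secs) _ _ (begin
    sum secs + (d + count F)                              ≡⟨ cong₂ (λ l f → sum secs + (l + f)) (trans (sym count-low) (count≡sum low)) (count≡sum F) ⟩
    sum secs + (sum (𝟙 ∘ low) + sum (𝟙 ∘ F))              ≡⟨ cong (sum secs +_) (∑-distrib-+ (𝟙 ∘ low) (𝟙 ∘ F)) ⟨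
    sum secs + sum (λ y → 𝟙 (low y) + 𝟙 (F y))            ≡⟨ ∑-distrib-+ secs _ ⟨
    sum (λ y → secs y + (𝟙 (low y) + 𝟙 (F y)))            ≤⟨ sum-mono-≤ pointwise-Y ⟩
    sum (λ y → 𝟙 (Y y) * outX y)                          ≡⟨ double-count Y X A ⟩
    sum (λ x → 𝟙 (X x) * inY x)                           ≤⟨ sum-mono-≤ pointwise-X ⟩
    sum (λ x → 𝟙 (X x) * secIn x + 𝟙 (exceptional x))      ≡⟨ ∑-distrib-+ (λ x → 𝟙 (X x) * secIn x) (𝟙 ∘ exceptional) ⟩
    sum (λ x → 𝟙 (X x) * secIn x) + sum (𝟙 ∘ exceptional)  ≡⟨ cong₂ _+_ (double-count Y X (secondOutN A)) (count≡sum exceptional) ⟨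
    sum secs + count exceptional                          ∎)
    where
    open ≤-Reasoning
    secs : Fin n → ℕ
    secs y = 𝟙 (Y y) * secX y

    in-Y : ∀ y k → y ∈ Y → secX y + k ≤ outX y → 𝟙 (Y y) * secX y + k ≤ 𝟙 (Y y) * outX y
    in-Y y k y∈Y h = subst (λ b → 𝟙 b * secX y + k ≤ 𝟙 b * outX y) (sym y∈Y)
      (subst₂ _≤_ (cong (_+ k) (sym (*-identityˡ (secX y)))) (sym (*-identityˡ (outX y))) h)

    -- At a low vertex `inY y` is `outY y` + 1, so the surplus is 2 if no in-neighbour in `Y` is
    -- missed and 1 if one is.
    low-gap : ∀ y k → y ∈ low → k + inY y ≤ suc (suc (secY y)) → secX y + k ≤ outX y
    low-gap y k y∈low h = gap k (sec<out y) (≤-pred (subst (_≤ suc (suc (secY y)))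
      (trans (cong (k +_) (trans (proj₂ oi) (sym (proj₁ oi)))) (+-suc k (outY y))) h))
      where oi = low-degrees y∈low

    pointwise-Y : ∀ y → secs y + (𝟙 (low y) + 𝟙 (F y)) ≤ 𝟙 (Y y) * outX y
    pointwise-Y y with bool-cases (Y y) | bool-cases (low y) | bool-cases (F y)
    ... | inj₁ y∈Y | inj₁ y∈low | inj₁ y∈F rewrite y∈low | y∈F = in-Y y 2 y∈Y (low-gap y 2 y∈low (s≤s (s≤s (full y y∈F))))
    ... | inj₁ y∈Y | inj₁ y∈low | inj₂ y∉F rewrite y∈low | y∉F = in-Y y 1 y∈Y (low-gap y 1 y∈low (s≤s (low-inY≤1+secY y∈low)))
    ... | inj₁ y∈Y | inj₂ y∉low | inj₂ y∉F rewrite y∉low | y∉F =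
          in-Y y 0 y∈Y (subst (_≤ outX y) (sym (+-identityʳ (secX y))) (high-secX≤outX y∈Y y∉low))
    ... | _        | inj₂ y∉low | inj₁ y∈F = ⊥-elim (true≢false (F⊆low y y∈F) y∉low)
    ... | inj₂ y∉Y | inj₁ y∈low | _        = ⊥-elim (true≢false (low⊆Y y y∈low) y∉Y)
    ... | inj₂ y∉Y | inj₂ y∉low | inj₂ y∉F rewrite y∉low | y∉F | y∉Y = z≤n

    pointwise-X : ∀ x → 𝟙 (X x) * inY x ≤ 𝟙 (X x) * secIn x + 𝟙 (exceptional x)
    pointwise-X x with bool-cases (Y x)
    ... | inj₁ x∈Y = subst (λ b → 𝟙 (not b) * inY x ≤ 𝟙 (not b) * secIn x + 𝟙 (exceptional x)) (sym x∈Y) z≤n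
    ... | inj₂ x∉Y = subst (λ b → 𝟙 (not b) * inY x ≤ 𝟙 (not b) * secIn x + 𝟙 (not b ∧ (secIn x <ᵇ inY x))) (sym x∉Y)
      (subst₂ (λ i g → i ≤ g + 𝟙 (secIn x <ᵇ inY x)) (sym (*-identityˡ (inY x))) (sym (*-identityˡ (secIn x))) bound)
      where
      bound : inY x ≤ secIn x + 𝟙 (secIn x <ᵇ inY x)
      bound with bool-cases (secIn x <ᵇ inY x)
      ... | inj₁ lt = subst (λ b → inY x ≤ secIn x + 𝟙 b) (sym lt)
            (subst (inY x ≤_) (+-comm 1 (secIn x)) (inY≤1+secIn x∉Y))
      ... | inj₂ ¬lt = ≤-trans (≮⇒≥ (λ lt → true≢false (<ᵇ-true lt) ¬lt)) (m≤m+n (secIn x) _)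

  -- The contradiction

  0<d : 0 < n → 0 < d
  0<d 0<n = *-cancelˡ-< 2 0 d (lemma (fromℕ< 0<n))
    where
    lemma : Fin n → 0 < 2 * d
    lemma u with bool-cases (Y u)
    ... | inj₁ u∈Y = subst (0 <_) |Y|≡2d (∈⇒count-positive Y u∈Y)
    -- A vertex of `X` also forces `d` to be positive, since the left side of `inY-bound` is a
    -- successor.
    ... | inj₂ u∉Y = ≤-trans (s≤s z≤n) (inY-bound u∉Y)

  no-exceptional : ∀ {x} → x ∈ exceptional → ⊥
  no-exceptional {x} x∈E with exceptional-elim x∈E
  ... | x∉Y , secIn<inY with count-<⇒∃ {p = low} {q = λ v → Y v ∧ A x v} low<out
    where
    -- There are only `d` low vertices and `outY x` exceeds `d`, so some out-neighbour `y` of `x` is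
    -- not low.
    low<out : count low < outY x
    low<out = subst (_< outY x) (sym count-low)
      (*-cancelˡ-< 2 d (outY x) (≤-trans (m≤m+n (suc (2 * d)) (secX x)) (outY-bound x∉Y)))
  ...   | y , xy′ , y∉low = arith (count W) (secX x) (inY x) (begin
      count W + count W   ≤⟨ +-monoˡ-≤ (count W) (subst (count W ≤_) count-low (count-mono E.unreaching⊆low)) ⟩
      d + count W         ≤⟨ exceptional-count W E.unreaching⊆low E.unreaching-full ⟩
      count exceptional   ≤⟨ count-cover {p = λ v → X v ∧ A y v} {q = λ v → X v ∧ secondOutN A y v} covered ⟩
      outX y + secX y     ≤⟨ +-monoʳ-≤ (outX y) (high-secX≤outX y∈Y y∉low) ⟩
      outX y + outX y     ≤⟨ +-mono-≤ (outX≤secX x∉Y xy) (outX≤secX x∉Y xy) ⟩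
      secX x + secX x     ∎) E.unreaching-size (inY-bound x∉Y)
    where
    open ≤-Reasoning
    module E = Exceptional x∉Y secIn<inY
    W : Fin n → Bool
    W = unreaching x∉Y
    y∈Y : y ∈ Y
    y∈Y = ∧-conicalˡ (Y y) _ xy′
    xy : A x y ≡ true
    xy = ∧-conicalʳ (Y y) _ xy′
    covered : exceptional ⊆ (λ v → X v ∧ A y v) ∪ (λ v → X v ∧ secondOutN A y v)
    covered v v∈E with bool-cases (A y v) | bool-cases (secondOutN A y v)
    ... | inj₁ yv  | _         = ∪-introˡ (λ v → X v ∧ A y v) (λ v → X v ∧ secondOutN A y v) (cong₂ _∧_ (∧-conicalˡ (X v) _ v∈E) yv)
    ... | inj₂ _   | inj₁ yyv  = ∪-introʳ (λ v → X v ∧ A y v) (λ v → X v ∧ secondOutN A y v) (cong₂ _∧_ (∧-conicalˡ (X v) _ v∈E) yyv)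
    -- Otherwise `y` would lie in the set `unreaching` belonging to `v`, which is contained in `low`
    -- because `v` is exceptional.
    ... | inj₂ ¬yv | inj₂ ¬yyv = let v∉Y , lt = exceptional-elim v∈E in
      ⊥-elim (true≢false (Exceptional.unreaching⊆low v∉Y lt y
        (cong₂ _∧_ y∈Y (cong₂ _∧_ (cong not ¬yv) (cong not ¬yyv)))) y∉low)
    arith : ∀ w b i → w + w ≤ b + b → suc (2 * d) ≤ 2 * i + w → suc b + 2 * i ≤ 2 * d → ⊥
    arith w b i h k l = <⇒≱ (+-mono-< b<w b<w) h
      where
      -- Both bounds involve 2 `inY x`: 2i + b < 2d + 1 ≤ 2i + w.
      b<w : b < w
      b<w = +-cancelʳ-≤ (2 * i) _ _ (≤-trans l (≤-trans (n≤1+n _) (subst (suc (2 * d) ≤_) (+-comm (2 * i) w) k)))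

  -- With `F` empty the double count already yields at least `d` exceptional vertices, and `d` is
  -- positive.
  absurd : 0 < n → ⊥
  absurd 0<n = no-exceptional (proj₂ (count-positive exceptional (begin
    1                              ≤⟨ 0<d 0<n ⟩
    d                              ≤⟨ m≤m+n d _ ⟩
    d + count {n} (λ _ → false)    ≤⟨ exceptional-count (λ _ → false) (λ _ ()) (λ _ ()) ⟩
    count exceptional              ∎)))
    where open ≤-Reasoning

theorem4p10 : (n d : ℕ) → 0 < n → (A : Digraph n) → (Y : Fin n → Bool) →
    Oriented A → IndependentX A Y → TournamentOn A Y → AlmostRegularOn A Y →
    count Y ≡ 2 * d →
    Σ (Fin n) (λ u → SeymourVertex A u)
theorem4p10 n d 0<n A Y oriented independent tournament almostRegular |Y|≡2d
  with any? (λ u → outdeg A u ≤? secondOutdeg A u)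
... | yes seymour = seymour
... | no ¬seymour = ⊥-elim (NoSeymourVertex.absurd A Y d oriented independent tournament almostRegular |Y|≡2d
        (λ u → ≰⇒> (λ h → ¬seymour (u , h))) 0<n)
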